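{- Let $n,k,\ell$ be integers with $2\leq \ell\leq n-1$ and $3\leq k\leq n$. Then $e_k(n,\ell,n-1)=n-1$.
   Context: All graphs are undirected, finite and simple. For a graph $G$ and a nonempty set $S\subseteq V(G)$, the Steiner distance $d_G(S)$ is the minimum number of edges of a connected subgraph (equivalently, a subtree) of $G$ whose vertex set contains $S$; set $d_G(S)=\infty$ if there is none. For $2\leq k\leq |V(G)|$, the Steiner $k$-diameter is $sdiam_k(G)=\max\{d_G(S): S\subseteq V(G),\ |S|=k\}$. For natural numbers $n,\ell,d$ with $d<n$, $\ell<n$, let $\mathscr{H}_k(n,\ell,d)$ be the set of all graphs $G$ of order $n$ with maximum degree exactly $\ell$ and $sdiam_k(G)\leq d$. Put $e_k(n,\ell,d)=\min\{|E(G)|: G\in \mathscr{H}_k(n,\ell,d)\}$, with $e_k(n,\ell,d)=\infty$ if $\mathscr{H}_k(n,\ell,d)=\emptyset$. -}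

module Defs where

open import Data.Bool.Base using (true; false)
open import Data.Fin.Base using (Fin)
import Data.Fin.Base as Fin
import Data.Fin.Properties as Fin
open import Data.Fin.Properties using (all?)
open import Data.Fin.Subset using (Subset; _∈_; _∉_; _⊆_; ∣_∣; Nonempty)
open import Data.Fin.Subset.Properties using (_∈?_; _⊆?_; nonempty?)
open import Data.List.Base using (List; []; _∷_; map; filter; length; allFin; cartesianProduct; cartesianProductWith; concatMap)
import Data.List.Extrema as Extrema
import Data.List.Membership.Propositional as List
open import Data.List.Membership.Propositional using (lose)
open import Data.List.Membership.Propositional.Properties using (∈-allFin; ∈-cartesianProductWith⁺; ∈-concatMap⁺)
open import Data.List.Relation.Unary.Any using (here; there)
open import Data.Nat.Base using (ℕ; _≤_)
import Data.Nat.Properties as ℕ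
open import Data.Product.Base using (_×_; _,_)
open import Data.Sum.Base using (_⊎_; inj₁; inj₂)
open import Data.Vec.Base using (Vec; []; _∷_; lookup)
open import Level using (0ℓ)
open import Relation.Binary.Bundles using (TotalOrder)
open import Relation.Binary.Construct.Closure.ReflexiveTransitive using (Star; ε; _◅_; _◅◅_)
import Relation.Binary.Construct.Add.Supremum.NonStrict as AddSup
open import Relation.Binary.PropositionalEquality using (_≡_; refl)
open import Relation.Nullary.Construct.Add.Supremum using (_⁺; [_]; ⊤⁺)
open import Relation.Nullary.Decidable using (Dec; yes; no; map′; recompute; ¬?; _×-dec_; _⊎-dec_; _→-dec_)
open import Relation.Nullary.Negation using (contradiction)

ℕ∞ : Set
ℕ∞ = ℕ ⁺

open AddSup _≤_ public using () renaming (_≤⁺_ to _≤∞_)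

≤∞-totalOrder : TotalOrder 0ℓ 0ℓ 0ℓ
≤∞-totalOrder = record { isTotalOrder = AddSup.≤⁺-isTotalOrder-≡ _≤_ ℕ.≤-isTotalOrder }

-- With these default values, min of the empty set is ∞ and max of the
-- empty set is 0.

min∞ : List ℕ∞ → ℕ∞
min∞ = Extrema.min ≤∞-totalOrder ⊤⁺

max∞ : List ℕ∞ → ℕ∞
max∞ = Extrema.max ≤∞-totalOrder [ 0 ]

maxℕ : List ℕ → ℕ
maxℕ = Extrema.max ℕ.≤-totalOrder 0

vecs : ∀ {A : Set} → List A → ∀ n → List (Vec A n)
vecs xs ℕ.zero    = [] ∷ []
vecs xs (ℕ.suc n) = cartesianProductWith _∷_ xs (vecs xs n)

vecs-complete : ∀ {A : Set} {xs : List A} → (∀ x → x List.∈ xs) →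
                ∀ {n} (v : Vec A n) → v List.∈ vecs xs n
vecs-complete all []      = here refl
vecs-complete all (x ∷ v) = ∈-cartesianProductWith⁺ _∷_ (all x) (vecs-complete all v)

subsets : ∀ n → List (Subset n)
subsets = vecs (false ∷ true ∷ [])

subsets-complete : ∀ {n} (S : Subset n) → S List.∈ subsets n
subsets-complete = vecs-complete λ where
  false → here refl
  true  → there (here refl)

-- A finite simple graph on the vertex set Fin n is given by the
-- neighbourhood of each vertex.

Simple : ∀ {n} → Vec (Subset n) n → Set
Simple N = (∀ u v → v ∈ lookup N u → u ∈ lookup N v) × (∀ u → u ∉ lookup N u)

simple? : ∀ {n} (N : Vec (Subset n) n) → Dec (Simple N)
simple? N =
  all? (λ u → all? λ v → (v ∈? lookup N u) →-dec (u ∈? lookup N v))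
  ×-dec all? (λ u → ¬? (u ∈? lookup N u))

-- The proof is irrelevant, so graphs with the same neighbourhoods
-- are equal; it is recovered by isSimple.

record Graph (n : ℕ) : Set where
  constructor mkGraph
  field
    neighbours : Vec (Subset n) n
    .simple    : Simple neighbours

open Graph public using (neighbours)

isSimple : ∀ {n} (G : Graph n) → Simple (neighbours G)
isSimple (mkGraph N s) = recompute (simple? N) s

N[_] : ∀ {n} → Graph n → Fin n → Subset n
N[ G ] = lookup (neighbours G)

Adj : ∀ {n} → Graph n → Fin n → Fin n → Set
Adj G u v = v ∈ N[ G ] u

adj? : ∀ {n} (G : Graph n) u v → Dec (Adj G u v)
adj? G u v = v ∈? N[ G ] u

fromNeighbours : ∀ {n} → Vec (Subset n) n → List (Graph n)
fromNeighbours N with simple? N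
... | yes s = mkGraph N s ∷ []
... | no  _ = []

graphs : ∀ n → List (Graph n)
graphs n = concatMap fromNeighbours (vecs (subsets n) n)

graphs-complete : ∀ {n} (G : Graph n) → G List.∈ graphs n
graphs-complete {n} G =
  ∈-concatMap⁺ fromNeighbours {xs = vecs (subsets n) n}
    (lose (vecs-complete subsets-complete (neighbours G)) (self G))
  where
  self : ∀ G → G List.∈ fromNeighbours (neighbours G)
  self G with simple? (neighbours G)
  ... | yes _  = here refl
  ... | no ¬s = contradiction (isSimple G) ¬s

-- Every edge {u , v} is counted once, as the pair with u < v.

edges : ∀ {n} → Graph n → List (Fin n × Fin n)
edges {n} G = filter (λ (u , v) → (u Fin.<? v) ×-dec adj? G u v)
                     (cartesianProduct (allFin n) (allFin n))

∣E_∣ : ∀ {n} → Graph n → ℕ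
∣E G ∣ = length (edges G)

degree : ∀ {n} → Graph n → Fin n → ℕ
degree G v = ∣ N[ G ] v ∣

Δ : ∀ {n} → Graph n → ℕ
Δ {n} G = maxℕ (map (degree G) (allFin n))

module Reachability {n} {R : Fin n → Fin n → Set} (R? : ∀ u v → Dec (R u v)) where

  -- Reachability with all intermediate vertices taken from a list.

  Via : List (Fin n) → Fin n → Fin n → Set
  Via []       u v = u ≡ v ⊎ R u v
  Via (w ∷ ws) u v = Via ws u v ⊎ (Via ws u w × Via ws w v)

  via? : ∀ ws u v → Dec (Via ws u v)
  via? []       u v = (u Fin.≟ v) ⊎-dec R? u v
  via? (w ∷ ws) u v = via? ws u v ⊎-dec (via? ws u w ×-dec via? ws w v)

  sound : ∀ ws {u v} → Via ws u v → Star R u v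
  sound []       (inj₁ refl)    = ε
  sound []       (inj₂ r)       = r ◅ ε
  sound (w ∷ ws) (inj₁ p)       = sound ws p
  sound (w ∷ ws) (inj₂ (p , q)) = sound ws p ◅◅ sound ws q

  base : ∀ ws {u v} → u ≡ v ⊎ R u v → Via ws u v
  base []       p = p
  base (w ∷ ws) p = inj₁ (base ws p)

  into : ∀ {ws u w} → Via (w ∷ ws) u w → Via ws u w
  into (inj₁ p)       = p
  into (inj₂ (p , _)) = p

  outof : ∀ {ws w v} → Via (w ∷ ws) w v → Via ws w v
  outof (inj₁ p)       = p
  outof (inj₂ (_ , q)) = q

  join : ∀ {ws u w v} → w List.∈ ws → Via ws u w → Via ws w v → Via ws u v
  join (here refl) p              q              = inj₂ (into p , outof q)
  join (there w∈)  (inj₁ p)       (inj₁ q)       = inj₁ (join w∈ p q)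
  join (there w∈)  (inj₁ p)       (inj₂ (q , r)) = inj₂ (join w∈ p q , r)
  join (there w∈)  (inj₂ (p , q)) (inj₁ r)       = inj₂ (p , join w∈ q r)
  join (there w∈)  (inj₂ (p , _)) (inj₂ (_ , r)) = inj₂ (p , r)

  complete : ∀ {u v} → Star R u v → Via (allFin n) u v
  complete ε        = base _ (inj₁ refl)
  complete (r ◅ rs) = join (∈-allFin _) (base _ (inj₂ r)) (complete rs)

  star? : ∀ u v → Dec (Star R u v)
  star? u v = map′ (sound _) complete (via? (allFin n) u v)

-- A subgraph has a vertex set W and an edge set; the latter is
-- represented by a graph F on Fin n whose edges all lie inside W.

IsSubgraph : ∀ {n} → Subset n → Graph n → Graph n → Set
IsSubgraph W F G = ∀ u v → Adj F u v → Adj G u v × u ∈ W × v ∈ W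

isSubgraph? : ∀ {n} (W : Subset n) (F G : Graph n) → Dec (IsSubgraph W F G)
isSubgraph? W F G = all? λ u → all? λ v →
  adj? F u v →-dec (adj? G u v ×-dec (u ∈? W) ×-dec (v ∈? W))

Connected : ∀ {n} → Subset n → Graph n → Set
Connected W F = Nonempty W × (∀ u v → u ∈ W → v ∈ W → Star (Adj F) u v)

connected? : ∀ {n} (W : Subset n) (F : Graph n) → Dec (Connected W F)
connected? W F = nonempty? W ×-dec all? λ u → all? λ v →
  (u ∈? W) →-dec (v ∈? W) →-dec Reachability.star? (adj? F) u v

IsConnectedSubgraphContaining : ∀ {n} → Graph n → Subset n → Subset n × Graph n → Set
IsConnectedSubgraphContaining G S (W , F) = IsSubgraph W F G × Connected W F × S ⊆ W

isConnectedSubgraphContaining? : ∀ {n} (G : Graph n) S H → Dec (IsConnectedSubgraphContaining G S H)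
isConnectedSubgraphContaining? G S (W , F) =
  isSubgraph? W F G ×-dec connected? W F ×-dec (S ⊆? W)

steinerDistance : ∀ {n} → Graph n → Subset n → ℕ∞
steinerDistance {n} G S =
  min∞ (map (λ (W , F) → [ ∣E F ∣ ])
    (filter (isConnectedSubgraphContaining? G S)
      (cartesianProduct (subsets n) (graphs n))))

sdiam : ∀ {n} → ℕ → Graph n → ℕ∞
sdiam {n} k G =
  max∞ (map (steinerDistance G) (filter (λ S → ∣ S ∣ ℕ.≟ k) (subsets n)))

ℋ : (k n ℓ d : ℕ) → Graph n → Set
ℋ k n ℓ d G = Δ G ≡ ℓ × sdiam k G ≤∞ [ d ]

ℋ? : ∀ k n ℓ d (G : Graph n) → Dec (ℋ k n ℓ d G)
ℋ? k n ℓ d G = (Δ G ℕ.≟ ℓ) ×-dec AddSup.≤⁺-dec _≤_ ℕ._≤?_ (sdiam k G) [ d ]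

e : (k n ℓ d : ℕ) → ℕ∞
e k n ℓ d = min∞ (map (λ G → [ ∣E G ∣ ]) (filter (ℋ? k n ℓ d) (graphs n)))

{-# OPTIONS --safe #-}

-- A graph of finite Steiner k-diameter with k ≥ 2 is connected, because
-- any two vertices lie in a common k-subset.  Contracting an edge of a
-- connected multigraph lowers the numbers of vertices and of edges by one
-- and keeps it connected, so with n vertices there are at least n − 1 edges.
-- The bound is attained by a broom, the star with centre 0 and leaves
-- 1 , … , ℓ with the path ℓ , ℓ + 1 , … , n − 1 attached: it is a tree,
-- hence itself connects every set of vertices with n − 1 edges.

module Submission where

open import Defs
open import Data.Fin.Base using (Fin; zero; suc; toℕ; inject₁; punchIn; punchOut)
import Data.Fin.Base as Fin
open import Data.Fin.Induction using (<-weakInduction)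
open import Data.Fin.Properties
  using (_≟_; any?; toℕ-inject₁; inject₁-injective; injective⇒≤; punchOut-cong; punchOut-punchIn; punchInᵢ≢i)
import Data.Fin.Properties as Fin
open import Data.Fin.Subset using (Subset; inside; outside; _∈_; _⊆_; ∣_∣; _∪_; ⁅_⁆; ⊤; ⊥)
open import Data.Fin.Subset.Properties
  using (∈⊤; ⊆⊤; ∣⊤∣≡n; ∣⊥∣≡0; ∣⁅x⁆∣≡1; p⊆q⇒∣p∣≤∣q∣; in⊆in; out⊆; x∈⁅x⁆; p⊆p∪q; q⊆p∪q; ∉⊥)
open import Data.List.Base using (List; []; _∷_; length; map; filter; allFin; cartesianProduct)
import Data.List.Base as List
open import Data.List.Extrema using (min≈v⁺; min≤v⁺; max≈v⁺; max≤v⁺; v≤max⁺)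
import Data.List.Membership.Propositional as List
open import Data.List.Membership.Propositional using (lose)
open import Data.List.Membership.Propositional.Properties
  using (∈-lookup; ∈-allFin; ∈-map⁺; ∈-map⁻; ∈-filter⁺; ∈-filter⁻; ∈-cartesianProduct⁺)
open import Data.List.Properties using (length-map; length-tabulate)
import Data.List.Relation.Unary.All as All
open import Data.List.Relation.Unary.Any as Any using (here; there)
open import Data.List.Relation.Unary.Any.Properties using (lookup-index)
open import Data.List.Relation.Unary.Unique.Propositional using (Unique; _∷_)
import Data.List.Relation.Unary.Unique.Propositional.Properties as Unique
open import Data.Nat.Base using (ℕ; zero; suc; _+_; _≤_; _<_; _∸_; z≤n; s≤s; s≤s⁻¹)
open import Data.Nat.Properties
  using (≤-refl; ≤-reflexive; ≤-trans; ≤-antisym; ≤-totalOrder; <-irrefl; <-asym; m≤n⇒m≤1+n; n≤1+n; +-suc; +-monoʳ-≤; _≤?_; _<?_; ≰⇒>)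
import Data.Nat.Properties as ℕ
open import Data.Product.Base using (∃; _×_; _,_; proj₁; proj₂)
open import Data.Sum.Base using (_⊎_; inj₁; inj₂; swap)
open import Data.Vec.Base as Vec using (Vec; []; _∷_; tabulate; here; there)
import Data.Vec.Membership.Propositional as Vec
import Data.Vec.Membership.Propositional.Properties as Vec
open import Data.Vec.Properties using ([]=⇒lookup; lookup⇒[]=; lookup∘tabulate)
open import Data.Vec.Relation.Unary.Any using (here; there)
open import Function.Base using (_∘_)
open import Relation.Binary.Bundles using (TotalOrder)
import Relation.Binary.Construct.Add.Supremum.NonStrict as AddSup
open import Relation.Binary.Construct.Closure.ReflexiveTransitive as Star
  using (Star; ε; _◅_; _◅◅_; fold; reverse)
open import Relation.Binary.Definitions using (tri<; tri≈; tri>)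
open import Relation.Binary.PropositionalEquality
  using (_≡_; _≢_; refl; sym; trans; cong; cong₂; subst; module ≡-Reasoning)
open import Relation.Nullary.Construct.Add.Supremum using ([_]; ⊤⁺)
open import Relation.Nullary.Decidable using (Dec; yes; no; does; dec-true; _×-dec_; _⊎-dec_)
open import Relation.Nullary.Negation using (¬_; contradiction)

open AddSup _≤_ using ([_]; _≤⊤⁺)
open TotalOrder ≤∞-totalOrder using () renaming (refl to ≤∞-refl; trans to ≤∞-trans)

-- Counting in finite lists and subsets.

lookup-injective : ∀ {A : Set} {xs : List A} → Unique xs →
                   ∀ i j → List.lookup xs i ≡ List.lookup xs j → i ≡ j
lookup-injective (x∉ ∷ _) zero    zero    _  = refl
lookup-injective (x∉ ∷ _) zero    (suc j) eq = contradiction eq (All.lookup x∉ (∈-lookup j))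
lookup-injective (x∉ ∷ _) (suc i) zero    eq = contradiction (sym eq) (All.lookup x∉ (∈-lookup i))
lookup-injective (_  ∷ u) (suc i) (suc j) eq = cong suc (lookup-injective u i j eq)

-- Sending a position in `xs` to the position of the same element in `ys` is injective, as `xs` has
-- no repetitions.
Unique-⊆⇒length≤ : ∀ {A : Set} {xs ys : List A} → Unique xs →
                   (∀ {x} → x List.∈ xs → x List.∈ ys) → length xs ≤ length ys
Unique-⊆⇒length≤ {xs = xs} {ys} unique xs⊆ys = injective⇒≤ λ {i} {j} eq →
  lookup-injective unique i j (begin
    List.lookup xs i                                ≡⟨ lookup-index (xs⊆ys (∈-lookup i)) ⟩
    List.lookup ys (Any.index (xs⊆ys (∈-lookup i))) ≡⟨ cong (List.lookup ys) eq ⟩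
    List.lookup ys (Any.index (xs⊆ys (∈-lookup j))) ≡⟨ lookup-index (xs⊆ys (∈-lookup j)) ⟨
    List.lookup xs j                                ∎)
  where open ≡-Reasoning

module _ {n} {P : Fin n → Set} (P? : ∀ v → Dec (P v)) where

  comprehension : Subset n
  comprehension = tabulate (does ∘ P?)

  ∈-comprehension⁺ : ∀ {v} → P v → v ∈ comprehension
  ∈-comprehension⁺ {v} p =
    lookup⇒[]= v _ (trans (lookup∘tabulate (does ∘ P?) v) (dec-true (P? v) p))

  ∈-comprehension⁻ : ∀ {v} → v ∈ comprehension → P v
  ∈-comprehension⁻ {v} v∈
    with P? v | trans (sym (lookup∘tabulate (does ∘ P?) v)) ([]=⇒lookup v∈)
  ... | yes p | _ = p

∣p∪q∣≤∣p∣+∣q∣ : ∀ {n} (p q : Subset n) → ∣ p ∪ q ∣ ≤ ∣ p ∣ + ∣ q ∣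
∣p∪q∣≤∣p∣+∣q∣ []            []            = z≤n
∣p∪q∣≤∣p∣+∣q∣ (outside ∷ p) (outside ∷ q) = ∣p∪q∣≤∣p∣+∣q∣ p q
∣p∪q∣≤∣p∣+∣q∣ (outside ∷ p) (inside  ∷ q) =
  ≤-trans (s≤s (∣p∪q∣≤∣p∣+∣q∣ p q)) (≤-reflexive (sym (+-suc ∣ p ∣ ∣ q ∣)))
∣p∪q∣≤∣p∣+∣q∣ (inside  ∷ p) (outside ∷ q) = s≤s (∣p∪q∣≤∣p∣+∣q∣ p q)
∣p∪q∣≤∣p∣+∣q∣ (inside  ∷ p) (inside  ∷ q) =
  s≤s (≤-trans (∣p∪q∣≤∣p∣+∣q∣ p q) (+-monoʳ-≤ ∣ p ∣ (n≤1+n ∣ q ∣)))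

∣⁅u⁆∪⁅v⁆∣≤2 : ∀ {n} (u v : Fin n) → ∣ ⁅ u ⁆ ∪ ⁅ v ⁆ ∣ ≤ 2
∣⁅u⁆∪⁅v⁆∣≤2 u v = ≤-trans (∣p∪q∣≤∣p∣+∣q∣ ⁅ u ⁆ ⁅ v ⁆)
  (≤-reflexive (cong₂ _+_ (∣⁅x⁆∣≡1 u) (∣⁅x⁆∣≡1 v)))

-- Scanning from the left, entries outside `p` stay out while the remaining positions can still hold
-- `k` elements; once they cannot, `k` is the full size and `⊤` is forced.
superset-of-size : ∀ {n k} (p : Subset n) → ∣ p ∣ ≤ k → k ≤ n →
                   ∃ λ q → p ⊆ q × ∣ q ∣ ≡ k
superset-of-size []            _           z≤n       = [] , (λ ()) , refl
superset-of-size (inside  ∷ p) (s≤s ∣p∣≤k) (s≤s k≤n) =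
  let q , p⊆q , ∣q∣≡k = superset-of-size p ∣p∣≤k k≤n
  in  inside ∷ q , in⊆in p⊆q , cong suc ∣q∣≡k
superset-of-size {suc n} {k} (outside ∷ p) ∣p∣≤k k≤1+n with k ≤? n
... | yes k≤n =
  let q , p⊆q , ∣q∣≡k = superset-of-size p ∣p∣≤k k≤n
  in  outside ∷ q , out⊆ p⊆q , ∣q∣≡k
... | no  k≰n = ⊤ , ⊆⊤ , trans (∣⊤∣≡n (suc n)) (≤-antisym (≰⇒> k≰n) k≤1+n)

initial : ∀ n → ℕ → Subset n
initial n       zero    = ⊥
initial zero    (suc ℓ) = []
initial (suc n) (suc ℓ) = inside ∷ initial n ℓ

∣initial∣ : ∀ {n ℓ} → ℓ ≤ n → ∣ initial n ℓ ∣ ≡ ℓ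
∣initial∣ {n} z≤n   = ∣⊥∣≡0 n
∣initial∣ (s≤s ℓ≤n) = cong suc (∣initial∣ ℓ≤n)

∈-initial⁺ : ∀ {n ℓ} (i : Fin n) → toℕ i < ℓ → i ∈ initial n ℓ
∈-initial⁺ zero    (s≤s _)   = here
∈-initial⁺ (suc i) (s≤s i<ℓ) = there (∈-initial⁺ i i<ℓ)

∈-initial⁻ : ∀ {n} ℓ {i : Fin n} → i ∈ initial n ℓ → toℕ i < ℓ
∈-initial⁻ zero    i∈         = contradiction i∈ ∉⊥
∈-initial⁻ (suc ℓ) here       = s≤s z≤n
∈-initial⁻ (suc ℓ) (there i∈) = s≤s (∈-initial⁻ ℓ i∈)

-- Contraction of connected multigraphs.

-- A multigraph is connected iff every function that is constant along its
-- edges is constant; in this form connectedness passes to a contraction by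
-- composing with the quotient map φ.

Constant : ∀ {n} → (Fin n → ℕ) → Set
Constant f = ∀ u v → f u ≡ f v

Respects : ∀ {n l} → Vec (Fin n × Fin n) l → (Fin n → ℕ) → Set
Respects es f = ∀ {u v} → (u , v) Vec.∈ es → f u ≡ f v

module Contraction {m} {u v : Fin (suc m)} (v≢u : v ≢ u) where

  φ : Fin (suc m) → Fin m
  φ w with v ≟ w
  ... | yes _  = punchOut v≢u
  ... | no v≢w = punchOut v≢w

  φ-identifies : φ u ≡ φ v
  φ-identifies with v ≟ u | v ≟ v
  ... | yes v≡u | _       = contradiction v≡u v≢u
  ... | no  _   | yes _   = punchOut-cong v refl
  ... | no  _   | no  v≢v = contradiction refl v≢v

  -- Makes `φ` surjective, so that constancy of `f ∘ φ` descends to `f`.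
  φ-punchIn : ∀ w → φ (punchIn v w) ≡ w
  φ-punchIn w with v ≟ punchIn v w
  ... | yes eq = contradiction (sym eq) (punchInᵢ≢i v w)
  ... | no  _  = trans (punchOut-cong v refl) (punchOut-punchIn v)

  contract : Fin (suc m) × Fin (suc m) → Fin m × Fin m
  contract (x , y) = φ x , φ y

-- Induction on the edges: a loop is dropped, any other edge is contracted. Loops and parallel edges
-- are allowed because contraction can create them.
connected⇒n≤1+l : ∀ {n l} (es : Vec (Fin n × Fin n) l) →
                  (∀ f → Respects es f → Constant f) → n ≤ suc l
connected⇒n≤1+l {zero}        es             _ = z≤n
connected⇒n≤1+l {suc zero}    []             _ = s≤s z≤n
-- With no edges every function respects them, yet `toℕ` separates two vertices.
connected⇒n≤1+l {suc (suc _)} []             const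
  with () ← const toℕ (λ ()) zero (suc zero)
connected⇒n≤1+l {suc m}       ((u , v) ∷ es) const with v ≟ u
-- A loop imposes no condition on `f`, so the remaining edges still connect all vertices.
... | yes refl = m≤n⇒m≤1+n (connected⇒n≤1+l es λ f resp →
  const f λ { (here refl) → refl ; (there e∈) → resp e∈ })
... | no  v≢u  = s≤s (connected⇒n≤1+l (Vec.map contract es) λ f resp x y → begin
    f x                  ≡⟨ cong f (φ-punchIn x) ⟨
    f (φ (punchIn v x))  ≡⟨ const (f ∘ φ) (lift f resp) _ _ ⟩
    f (φ (punchIn v y))  ≡⟨ cong f (φ-punchIn y) ⟩
    f y                  ∎)
  where
  open ≡-Reasoning
  open Contraction v≢u

  lift : ∀ f → Respects (Vec.map contract es) f → Respects ((u , v) ∷ es) (f ∘ φ)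
  lift f resp (here refl) = cong f φ-identifies
  lift f resp (there e∈)  = resp (Vec.∈-map⁺ contract e∈)

-- Edge count of a connected graph.

edge? : ∀ {n} (G : Graph n) ((u , v) : Fin n × Fin n) → Dec (u Fin.< v × Adj G u v)
edge? G (u , v) = (u Fin.<? v) ×-dec adj? G u v

∈-edges⁺ : ∀ {n} (G : Graph n) {u v} → u Fin.< v → Adj G u v → (u , v) List.∈ edges G
∈-edges⁺ G u<v adj =
  ∈-filter⁺ (edge? G) (∈-cartesianProduct⁺ (∈-allFin _) (∈-allFin _)) (u<v , adj)

∈-edges⁻ : ∀ {n} (G : Graph n) {u v} → (u , v) List.∈ edges G → u Fin.< v × Adj G u v
∈-edges⁻ {n} G e∈ = proj₂ (∈-filter⁻ (edge? G) {xs = cartesianProduct (allFin n) (allFin n)} e∈)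

edges-unique : ∀ {n} (G : Graph n) → Unique (edges G)
edges-unique {n} G =
  Unique.filter⁺ (edge? G) (Unique.cartesianProduct⁺ (Unique.allFin⁺ n) (Unique.allFin⁺ n))

connected⇒n≤1+∣E∣ : ∀ {n} (G : Graph n) → (∀ u v → Star (Adj G) u v) → n ≤ suc ∣E G ∣
connected⇒n≤1+∣E∣ G conn = connected⇒n≤1+l es λ f resp u v →
  fold (λ x y → f x ≡ f y) (λ adj → trans (respectsAdj f resp adj)) refl (conn u v)
  where
  es : Vec _ ∣E G ∣
  es = Vec.fromList (edges G)

  respectsAdj : ∀ f → Respects es f → ∀ {x y} → Adj G x y → f x ≡ f y
  -- `edges` lists each pair with its smaller end first, so the reversed case goes through symmetry
  -- of adjacency.
  respectsAdj f resp {x} {y} adj with Fin.<-cmp x y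
  ... | tri< x<y _ _    = resp (Vec.∈-fromList⁺ (∈-edges⁺ G x<y adj))
  ... | tri≈ _ refl _   = refl
  ... | tri> _ _ y<x    = sym (resp (Vec.∈-fromList⁺ (∈-edges⁺ G y<x (proj₁ (isSimple G) x y adj))))

-- Finite Steiner diameter and connectedness.

finite⇒connectedSubgraph : ∀ {n d} (G : Graph n) S → steinerDistance G S ≤∞ [ d ] →
                           ∃ (IsConnectedSubgraphContaining G S)
finite⇒connectedSubgraph {n} G S fin
  with filter (isConnectedSubgraphContaining? G S) (cartesianProduct (subsets n) (graphs n))
     -- Abstracted together with the list, so that it speaks of the list being matched.
     | (λ {H} → ∈-filter⁻ (isConnectedSubgraphContaining? G S) {v = H} {xs = cartesianProduct (subsets n) (graphs n)})
-- With no candidate the minimum is its default `⊤⁺`, which is below no `[ d ]`.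
... | []    | _  with () ← fin
... | H ∷ _ | ∈⁻ = H , proj₂ (∈⁻ (here refl))

steinerDistance≤sdiam : ∀ {n} k (G : Graph n) S → ∣ S ∣ ≡ k → steinerDistance G S ≤∞ sdiam k G
steinerDistance≤sdiam k G S ∣S∣≡k = v≤max⁺ ≤∞-totalOrder [ 0 ] _
  (inj₂ (lose (∈-map⁺ (steinerDistance G) (∈-filter⁺ _ (subsets-complete S) ∣S∣≡k)) ≤∞-refl))

finite⇒connected : ∀ {n k d} (G : Graph n) → 2 ≤ k → k ≤ n → sdiam k G ≤∞ [ d ] →
                   ∀ u v → Star (Adj G) u v
finite⇒connected {k = k} G 2≤k k≤n fin u v =
  let S , uv⊆S , ∣S∣≡k = superset-of-size (⁅ u ⁆ ∪ ⁅ v ⁆) (≤-trans (∣⁅u⁆∪⁅v⁆∣≤2 u v) 2≤k) k≤n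
      (W , F) , sub , (_ , conn) , S⊆W =
        finite⇒connectedSubgraph G S (≤∞-trans (steinerDistance≤sdiam k G S ∣S∣≡k) fin)
  in  Star.map (λ {x} {y} adj → proj₁ (sub x y adj))
        (conn u v (S⊆W (uv⊆S (p⊆p∪q ⁅ v ⁆ (x∈⁅x⁆ u)))) (S⊆W (uv⊆S (q⊆p∪q ⁅ u ⁆ _ (x∈⁅x⁆ v)))))

-- The whole graph is a candidate for every `S`; order `suc n` provides the vertex that `Connected`
-- asks for.
connected⇒sdiam≤∣E∣ : ∀ {n} k (G : Graph (suc n)) → (∀ u v → Star (Adj G) u v) →
                      sdiam k G ≤∞ [ ∣E G ∣ ]
-- `[ z≤n ]` covers the default value 0 of `max∞`.
connected⇒sdiam≤∣E∣ {n} k G conn = max≤v⁺ ≤∞-totalOrder [ z≤n ] (All.tabulate bound)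
  where
  whole : ∀ S → IsConnectedSubgraphContaining G S (⊤ , G)
  whole S = (λ u v adj → adj , ∈⊤ , ∈⊤) , ((zero , ∈⊤) , λ u v _ _ → conn u v) , ⊆⊤

  bound : ∀ {d} → d List.∈ map (steinerDistance G) (filter (λ S → ∣ S ∣ ℕ.≟ k) (subsets (suc n))) →
          d ≤∞ [ ∣E G ∣ ]
  bound d∈ with S , _ , refl ← ∈-map⁻ (steinerDistance G) d∈ =
    min≤v⁺ ≤∞-totalOrder ⊤⁺ _ (inj₂ (lose
      (∈-map⁺ _ (∈-filter⁺ (isConnectedSubgraphContaining? G S)
        (∈-cartesianProduct⁺ (subsets-complete ⊤) (graphs-complete G)) (whole S)))
      [ ≤-refl ]))

-- The broom as a rooted tree.

module Broom (m ℓ : ℕ) where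

  -- The tree is encoded by parents, with one edge for each non-root vertex `suc i`; `inject₁ i` is
  -- the vertex numbered one less.
  parent : Fin m → Fin (suc m)
  parent i with toℕ i <? ℓ
  ... | yes _ = zero
  ... | no  _ = inject₁ i

  parent-< : ∀ i → parent i Fin.< suc i
  parent-< i with toℕ i <? ℓ
  ... | yes _ = s≤s z≤n
  ... | no  _ = s≤s (≤-reflexive (toℕ-inject₁ i))

  0≡parent⁺ : ∀ {i} → toℕ i < ℓ → zero ≡ parent i
  0≡parent⁺ {i} i<ℓ with toℕ i <? ℓ
  ... | yes _   = refl
  ... | no  i≮ℓ = contradiction i<ℓ i≮ℓ

  -- On the path the parent is `inject₁ i`, which is the root only for `i = zero`; but 0 < ℓ puts
  -- that index in the star.
  0≡parent⁻ : 2 ≤ ℓ → ∀ {i} → zero ≡ parent i → toℕ i < ℓ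
  0≡parent⁻ 2≤ℓ {i} 0≡ with toℕ i <? ℓ
  ... | yes i<ℓ = i<ℓ
  0≡parent⁻ 2≤ℓ {zero} _ | no 0≮ℓ = contradiction (≤-trans (s≤s z≤n) 2≤ℓ) 0≮ℓ

  -- In the star every parent is the root, so other vertices are parents only along the path. As
  -- `inject₁` is injective, each of them has at most one child.
  suc≡parent⇒inject₁ : ∀ {i j} → suc i ≡ parent j → suc i ≡ inject₁ j
  suc≡parent⇒inject₁ {j = j} eq with toℕ j <? ℓ
  ... | no _ = eq

  data _Parent_ (u : Fin (suc m)) : Fin (suc m) → Set where
    parent-of : ∀ {i} → u ≡ parent i → u Parent (suc i)

  parent? : ∀ u v → Dec (u Parent v)
  parent? u zero    = no λ ()
  parent? u (suc i) with u ≟ parent i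
  ... | yes eq = yes (parent-of eq)
  ... | no ¬eq = no λ { (parent-of eq) → ¬eq eq }

  -- Excludes loops and orients each edge the way `edges` lists it.
  Parent⇒< : ∀ {u v} → u Parent v → u Fin.< v
  Parent⇒< (parent-of {i} refl) = parent-< i

  linked? : ∀ u v → Dec (u Parent v ⊎ v Parent u)
  linked? u v = parent? u v ⊎-dec parent? v u

  neighbourhood : Fin (suc m) → Subset (suc m)
  neighbourhood u = comprehension (linked? u)

  linked⁺ : ∀ {u v} → u Parent v ⊎ v Parent u → v ∈ Vec.lookup (tabulate neighbourhood) u
  linked⁺ {u} {v} l =
    subst (v ∈_) (sym (lookup∘tabulate neighbourhood u)) (∈-comprehension⁺ (linked? u) l)

  linked⁻ : ∀ {u v} → v ∈ Vec.lookup (tabulate neighbourhood) u → u Parent v ⊎ v Parent u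
  linked⁻ {u} {v} v∈ =
    ∈-comprehension⁻ (linked? u) (subst (v ∈_) (lookup∘tabulate neighbourhood u) v∈)

  broom : Graph (suc m)
  broom = mkGraph (tabulate neighbourhood)
    ((λ u v → linked⁺ ∘ swap ∘ linked⁻) , λ u u∈ → irrefl (linked⁻ u∈))
    where
    irrefl : ∀ {u} → ¬ (u Parent u ⊎ u Parent u)
    irrefl (inj₁ p) = <-irrefl refl (Parent⇒< p)
    irrefl (inj₂ p) = <-irrefl refl (Parent⇒< p)

  toRoot : ∀ u → Star (Adj broom) u zero
  toRoot = <-weakInduction _ ε step
    where
    edge : ∀ i → Adj broom (suc i) (parent i)
    edge i = linked⁺ (inj₂ (parent-of refl))

    step : ∀ i → Star (Adj broom) (inject₁ i) zero → Star (Adj broom) (suc i) zero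
    -- `edge i` is abstracted along with the comparison so that `parent i` reduces in its type.
    step i path with toℕ i <? ℓ | edge i
    ... | yes _ | adj = adj ◅ ε
    ... | no  _ | adj = adj ◅ path

  connected : ∀ u v → Star (Adj broom) u v
  connected u v = toRoot u ◅◅ reverse (λ {x} {y} → proj₁ (isSimple broom) x y) (toRoot v)

  -- Every edge joins some `suc i` to its parent, which leaves at most `m` edges; connectedness of
  -- the broom gives the converse bound.
  ∣E∣≡m : ∣E broom ∣ ≡ m
  ∣E∣≡m = ≤-antisym
    (≤-trans (Unique-⊆⇒length≤ (edges-unique broom) edge∈)
             (≤-reflexive (trans (length-map _ (allFin m)) (length-tabulate {n = m} _))))
    (s≤s⁻¹ (connected⇒n≤1+∣E∣ broom connected))
    where
    edge∈ : ∀ {e} → e List.∈ edges broom → e List.∈ map (λ i → parent i , suc i) (allFin m)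
    edge∈ {u , v} e∈ with u<v , adj ← ∈-edges⁻ broom e∈ with linked⁻ {u} {v} adj
    ... | inj₁ (parent-of {i} refl) = ∈-map⁺ _ (∈-allFin i)
    ... | inj₂ v-parent-u           = contradiction (Parent⇒< v-parent-u) (<-asym u<v)

  degree-root : 2 ≤ ℓ → ℓ ≤ m → degree broom zero ≡ ℓ
  degree-root 2≤ℓ ℓ≤m = trans
    (≤-antisym (p⊆q⇒∣p∣≤∣q∣ N⊆) (p⊆q⇒∣p∣≤∣q∣ ⊆N))
    (∣initial∣ ℓ≤m)
    where
    -- The leading `outside` is the root itself; index `i` of `initial m ℓ` stands for the vertex
    -- `suc i`.
    N⊆ : N[ broom ] zero ⊆ outside ∷ initial m ℓ
    N⊆ {v} v∈ with linked⁻ {zero} {v} v∈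
    ... | inj₁ (parent-of 0≡) = there (∈-initial⁺ _ (0≡parent⁻ 2≤ℓ 0≡))

    ⊆N : outside ∷ initial m ℓ ⊆ N[ broom ] zero
    ⊆N (there i∈) = linked⁺ (inj₁ (parent-of (0≡parent⁺ (∈-initial⁻ ℓ i∈))))

  -- The neighbours are the parent and at most one child.
  degree-nonroot : ∀ i → degree broom (suc i) ≤ 2
  degree-nonroot i with any? (λ j → suc i ≟ parent j)
  ... | yes (j , i-parent-j) = ≤-trans (p⊆q⇒∣p∣≤∣q∣ N⊆) (∣⁅u⁆∪⁅v⁆∣≤2 (parent i) (suc j))
    where
    N⊆ : N[ broom ] (suc i) ⊆ ⁅ parent i ⁆ ∪ ⁅ suc j ⁆
    N⊆ {v} v∈ with linked⁻ {suc i} {v} v∈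
    ... | inj₂ (parent-of refl) = p⊆p∪q _ (x∈⁅x⁆ _)
    ... | inj₁ (parent-of {j′} i-parent-j′)
      with refl ← inject₁-injective {i = j} {j = j′}
                    (trans (sym (suc≡parent⇒inject₁ i-parent-j)) (suc≡parent⇒inject₁ i-parent-j′)) =
        q⊆p∪q ⁅ parent i ⁆ _ (x∈⁅x⁆ (suc j))
  ... | no childless = ≤-trans (p⊆q⇒∣p∣≤∣q∣ N⊆) (≤-trans (≤-reflexive (∣⁅x⁆∣≡1 (parent i))) (s≤s z≤n))
    where
    N⊆ : N[ broom ] (suc i) ⊆ ⁅ parent i ⁆
    N⊆ {v} v∈ with linked⁻ {suc i} {v} v∈
    ... | inj₂ (parent-of refl) = x∈⁅x⁆ _
    ... | inj₁ (parent-of {j} i-parent-j) = contradiction (j , i-parent-j) childless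

  Δ≡ℓ : 2 ≤ ℓ → ℓ ≤ m → Δ broom ≡ ℓ
  Δ≡ℓ 2≤ℓ ℓ≤m = max≈v⁺ ≤-totalOrder
    (subst (List._∈ degrees) (degree-root 2≤ℓ ℓ≤m) (∈-map⁺ (degree broom) (∈-allFin zero)))
    (All.tabulate degrees≤ℓ)
    -- The default value 0 of `maxℕ` does not exceed `ℓ`.
    z≤n
    where
    degrees : List ℕ
    degrees = map (degree broom) (allFin (suc m))

    bound : ∀ v → degree broom v ≤ ℓ
    bound zero    = ≤-reflexive (degree-root 2≤ℓ ℓ≤m)
    -- The hypothesis `2 ≤ ℓ` keeps the path vertices from exceeding the degree of the root.
    bound (suc i) = ≤-trans (degree-nonroot i) 2≤ℓ

    degrees≤ℓ : ∀ {d} → d List.∈ degrees → d ≤ ℓ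
    degrees≤ℓ d∈ with v , _ , refl ← ∈-map⁻ (degree broom) {xs = allFin (suc m)} d∈ = bound v

theorem2p1 : (n k ℓ : ℕ) → 2 ≤ ℓ → ℓ ≤ n ∸ 1 → 3 ≤ k → k ≤ n → e k n ℓ (n ∸ 1) ≡ [ n ∸ 1 ]
theorem2p1 zero    k ℓ 2≤ℓ ℓ≤0 _ _ = contradiction (≤-trans 2≤ℓ ℓ≤0) λ ()
-- The value `m` is attained by the broom, bounds all sizes from below, and lies below the default
-- `⊤⁺` of `min∞`.
theorem2p1 (suc m) k ℓ 2≤ℓ ℓ≤m 3≤k k≤n = min≈v⁺ ≤∞-totalOrder
  (subst (λ d → [ d ] List.∈ sizes) ∣E∣≡m
    (∈-map⁺ _ (∈-filter⁺ (ℋ? k (suc m) ℓ m) (graphs-complete broom) broom∈ℋ)))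
  (All.tabulate lower)
  ([ m ] ≤⊤⁺)
  where
  open Broom m ℓ

  sizes : List ℕ∞
  sizes = map (λ G → [ ∣E G ∣ ]) (filter (ℋ? k (suc m) ℓ m) (graphs (suc m)))

  broom∈ℋ : ℋ k (suc m) ℓ m broom
  broom∈ℋ = Δ≡ℓ 2≤ℓ ℓ≤m , subst (λ d → sdiam k broom ≤∞ [ d ]) ∣E∣≡m (connected⇒sdiam≤∣E∣ k broom connected)

  lower : ∀ {d} → d List.∈ sizes → [ m ] ≤∞ d
  lower d∈ with G , G∈ , refl ← ∈-map⁻ _ d∈
    with _ , _ , fin ← ∈-filter⁻ (ℋ? k (suc m) ℓ m) {xs = graphs (suc m)} G∈ =
    [ s≤s⁻¹ (connected⇒n≤1+∣E∣ G (finite⇒connected G (≤-trans (n≤1+n 2) 3≤k) k≤n fin)) ]
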